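{- Let $q$ be a prime power, $n$ a positive integer, $\gamma\in\mathbb{F}_{q^n}^{*}$, and let $u_1,\dots,u_{n-1}\in\mathbb{F}_{q^n}$ be such that $u_1,\dots,u_{n-1},\gamma$ is a basis of $\mathbb{F}_{q^n}$ over $\mathbb{F}_q$. Let $H(x)\in\mathbb{F}_{q^n}[x]$ be a polynomial such that $\mathrm{Tr}(H(x))$ is not a constant map on $\mathbb{F}_{q^n}$. Then there are at least $$\big((q^{n-1})!\big)^q-(q^n-q)(q^n-q^2)\cdots(q^n-q^{n-1})$$ permutation polynomials over $\mathbb{F}_{q^n}$ of the form $$u_1f_1(x)+\dots+u_{n-1}f_{n-1}(x)+\gamma\mathrm{Tr}(H_1(x))+\gamma\mathrm{Tr}(H(x)),$$ with $f_1,\dots,f_{n-1}$ maps from $\mathbb{F}_{q^n}$ to $\mathbb{F}_q$ and $H_1(x)\in\mathbb{F}_{q^n}[x]$, such that $$G(x)=u_1f_1(x)+\dots+u_{n-1}f_{n-1}(x)+\gamma\mathrm{Tr}(H_1(x))$$ is neither a permutation nor a linearized polynomial.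
   Context: $\mathrm{Tr}(x)=x+x^q+\dots+x^{q^{n-1}}$ is the trace from $\mathbb{F}_{q^n}$ to $\mathbb{F}_q$. Polynomials over $\mathbb{F}_{q^n}$ are identified with the maps $\mathbb{F}_{q^n}\to\mathbb{F}_{q^n}$ they induce (i.e. taken modulo $x^{q^n}-x$), and are counted as such. A polynomial is a permutation (polynomial) over $\mathbb{F}_{q^n}$ if it induces a bijection of $\mathbb{F}_{q^n}$. A linearized polynomial (also called $q$-polynomial) is one of the form $\sum_{i=0}^{n-1}a_ix^{q^i}$ with $a_i\in\mathbb{F}_{q^n}$. For $n=1$ the sums over $u_if_i$ are empty and the product $(q^n-q)\cdots(q^n-q^{n-1})$ is the empty product $1$. -}

module Defs where

open import Algebra.Bundles using (CommutativeRing)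
open import Algebra.Morphism.Structures using (module RingMorphisms)
import Algebra.Properties.Monoid.Sum as MonoidSum
import Algebra.Properties.Semiring.Exp as SemiringExp
open import Data.Fin.Base using (Fin; toℕ)
open import Data.List.Base using (List; foldr; applyUpTo; product)
open import Data.Nat.Base as ℕ using (ℕ; suc; pred; NonZero; _∸_)
open import Data.Nat.Primality using (Prime)
open import Data.Product.Base using (∃₂; ∃-syntax; Σ-syntax; _×_)
open import Data.Vec.Functional using (Vector)
open import Function.Bundles using (Inverse; Func)
open import Function.Definitions using (Bijective)
open import Level using (Level; _⊔_) renaming (suc to lsuc)
open import Relation.Binary.Bundles using (Setoid)
open import Relation.Binary.PropositionalEquality as ≡ using (_≡_)
open import Relation.Nullary.Negation using (¬_)

IsPrimePower : ℕ → Set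
IsPrimePower q = ∃₂ λ p k → Prime p × NonZero k × q ≡ p ℕ.^ k

-- (qⁿ − q)(qⁿ − q²)⋯(qⁿ − qⁿ⁻¹).  As qⁱ ≤ qⁿ in every factor (for q > 0), the
-- truncated subtraction agrees with subtraction in ℤ.
factorProduct : ℕ → ℕ → ℕ
factorProduct q n = product (applyUpTo (λ i → q ℕ.^ n ∸ q ℕ.^ suc i) (pred n))

-- A field with exactly `size` elements, up to its setoid equality.
record FiniteField (c ℓ : Level) (size : ℕ) : Set (lsuc (c ⊔ ℓ)) where
  field
    commutativeRing : CommutativeRing c ℓ
  open CommutativeRing commutativeRing public
  field
    1≉0     : 1# ≉ 0#
    inverse : ∀ x → x ≉ 0# → ∃[ y ] x * y ≈ 1#
    finite  : Inverse setoid (≡.setoid (Fin size))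

-- 𝔽_q and 𝔽_{qⁿ} together with the inclusion of the former in the latter.
record FiniteFieldExtension (c₁ ℓ₁ c₂ ℓ₂ : Level) (q n : ℕ)
       : Set (lsuc (c₁ ⊔ ℓ₁ ⊔ c₂ ⊔ ℓ₂)) where
  field
    𝔽q  : FiniteField c₁ ℓ₁ q
    𝔽qⁿ : FiniteField c₂ ℓ₂ (q ℕ.^ n)

  module k = FiniteField 𝔽q
  module K = FiniteField 𝔽qⁿ

  field
    ι     : k.Carrier → K.Carrier
    ιmono : RingMorphisms.IsRingMonomorphism k.rawRing K.rawRing ι

  open K using (_≈_; _+_; _*_; 0#)
  open SemiringExp K.semiring using (_^_)
  open MonoidSum K.+-monoid using (sum)

  linearCombination : ∀ {m} → Vector k.Carrier m → Vector K.Carrier m → K.Carrier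
  linearCombination a v = sum (λ i → ι (a i) * v i)

  LinearlyIndependent : ∀ {m} → Vector K.Carrier m → Set (c₁ ⊔ ℓ₁ ⊔ ℓ₂)
  LinearlyIndependent v =
    ∀ a → linearCombination a v ≈ 0# → ∀ i → a i k.≈ k.0#

  Spanning : ∀ {m} → Vector K.Carrier m → Set (c₁ ⊔ c₂ ⊔ ℓ₂)
  Spanning v = ∀ x → Σ[ a ∈ Vector k.Carrier _ ] linearCombination a v ≈ x

  IsBasis : ∀ {m} → Vector K.Carrier m → Set (c₁ ⊔ ℓ₁ ⊔ c₂ ⊔ ℓ₂)
  IsBasis v = LinearlyIndependent v × Spanning v

  Tr : K.Carrier → K.Carrier
  Tr x = sum {n} (λ i → x ^ (q ℕ.^ toℕ i))

  -- Lists of coefficients, constant term first.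
  Poly : Set c₂
  Poly = List K.Carrier

  ⟦_⟧ : Poly → K.Carrier → K.Carrier
  ⟦ P ⟧ x = foldr (λ a r → a + x * r) 0# P

  -- Polynomials are identified when they induce the same map, i.e. when they
  -- are congruent modulo x^(qⁿ) − x.
  polySetoid : Setoid c₂ (c₂ ⊔ ℓ₂)
  polySetoid = record
    { Carrier       = Poly
    ; _≈_           = λ P Q → ∀ x → ⟦ P ⟧ x ≈ ⟦ Q ⟧ x
    ; isEquivalence = record
      { refl  = λ x → K.refl
      ; sym   = λ e x → K.sym (e x)
      ; trans = λ e f x → K.trans (e x) (f x)
      }
    }

  -- The following are predicates on maps 𝔽_{qⁿ} → 𝔽_{qⁿ}; in accordance with
  -- the identification above, a polynomial has them when its induced map does.
  IsConstant : (K.Carrier → K.Carrier) → Set (c₂ ⊔ ℓ₂)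
  IsConstant f = ∃[ b ] (∀ x → f x ≈ b)

  IsPermutation : (K.Carrier → K.Carrier) → Set (c₂ ⊔ ℓ₂)
  IsPermutation = Bijective _≈_ _≈_

  IsLinearized : (K.Carrier → K.Carrier) → Set (c₂ ⊔ ℓ₂)
  IsLinearized f =
    Σ[ a ∈ Vector K.Carrier n ] (∀ x → f x ≈ sum (λ i → a i * x ^ (q ℕ.^ toℕ i)))

  module _ (u : Vector K.Carrier (pred n)) (γ : K.Carrier) where

    -- u₁f₁(x) + ⋯ + uₙ₋₁fₙ₋₁(x) + γ Tr(H₁(x))
    G : Vector (Func K.setoid k.setoid) (pred n) → Poly → K.Carrier → K.Carrier
    G f H₁ x = sum (λ i → u i * ι (Func.to (f i) x)) + γ * Tr (⟦ H₁ ⟧ x)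

    IsPermutationOfForm : Poly → Poly → Set (c₁ ⊔ ℓ₁ ⊔ c₂ ⊔ ℓ₂)
    IsPermutationOfForm H P =
      IsPermutation ⟦ P ⟧ ×
      ∃₂ λ f H₁ →
        (∀ x → ⟦ P ⟧ x ≈ G f H₁ x + γ * Tr (⟦ H ⟧ x)) ×
        ¬ IsPermutation (G f H₁) ×
        ¬ IsLinearized (G f H₁)

{-# OPTIONS --safe #-}
module Submission where

{- Write c x ∈ 𝔽q for the γ-coordinate of x and Tr (H x) = ι (t x).  If P is a
   permutation then G = P - γ Tr H has γ-coordinate c (P x) - t x.  There is a
   permutation w for which g x = c (w x) - t x does not have all fibres of equal
   size and g 0 ≠ 0: if a, b satisfy t a ≠ t b and c a ≠ c b, then the identity
   and the transposition (a b) give different fibre sizes, so one of the two is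
   unbalanced, and adding γ to w repairs g 0 = 0.  For every π permuting each
   fibre of c, P = π ∘ w has c ∘ P = c ∘ w, so G is neither a permutation (its
   γ-coordinate is unbalanced) nor linearized (G 0 ≠ 0).  This already gives
   ((qⁿ⁻¹)!)^q permutations, with nothing to subtract.  That every such P is of
   the required form is Lagrange interpolation together with Tr 𝔽qⁿ = ι 𝔽q. -}

open import Defs
open import Algebra.Bundles using (CommutativeMonoid)
open import Algebra.Morphism.Structures using (module RingMorphisms)
open import Algebra.Properties.CommutativeMonoid.Sum as CommutativeMonoidSum using ()
import Algebra.Properties.CommutativeSemiring.Binomial as Binomial
import Algebra.Properties.CommutativeSemiring.Exp as Exp
import Algebra.Properties.Group as GroupProperties
import Algebra.Properties.Monoid.Mult as MonoidMult
import Algebra.Properties.Ring as RingProperties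
import Algebra.Properties.Semiring.Exp as SemiringExp
import Algebra.Properties.Semiring.Mult as Mult
import Algebra.Properties.Semiring.Sum as SemiringSum
import Algebra.Solver.Ring.NaturalCoefficients.Default as SemiringSolver
open import Data.Fin.Base
  using (Fin; zero; suc; toℕ; fromℕ; inject₁; inject≤; punchIn; combine; quotient; remainder; funToFin; finToFun)
open import Data.Fin.Permutation as Perm using (Permutation′; _⟨$⟩ʳ_)
import Data.Fin.Properties as Fin
import Data.Integer.Base as ℤ
import Data.Integer.Properties as ℤ
open import Data.List.Base as List using (List; foldr; length; tabulate)
open import Data.List.Properties using (length-tabulate)
open import Data.List.Relation.Unary.All using (All)
import Data.List.Relation.Unary.All.Properties as AllProperties
open import Data.List.Relation.Unary.Unique.Setoid using (Unique)
import Data.List.Relation.Unary.Unique.Setoid.Properties as UniqueProperties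
open import Data.Nat.Base as ℕ using (ℕ; zero; suc; pred; z≤n; s≤s)
open import Data.Nat.Combinatorics using (_C_; nC1≡n; nCn≡1; nCk+nC[k+1]≡[n+1]C[k+1])
open import Data.Nat.Divisibility using (_∣_; divides; ∣⇒≤; n∣m*n)
open import Data.Nat.Primality using (Prime; euclidsLemma; ¬prime[0])
import Data.Nat.Properties as ℕ
open import Data.Nat.Tactic.RingSolver using (solve-∀)
open import Data.Product.Base using (Σ-syntax; ∃-syntax; _×_; _,_; proj₁; proj₂)
open import Data.Sum.Base using (inj₁; inj₂)
open import Data.Vec.Functional using (Vector; _∷_; replicate; removeAt; init)
open import Function.Base using (_∘_)
open import Function.Bundles using (Func; Inverse)
import Function.Construct.Composition as Composition
import Function.Construct.Identity as Identity
open import Function.Definitions using (Bijective)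
open import Level using (_⊔_)
open import Relation.Binary.PropositionalEquality as ≡ using (_≡_; _≢_; _≗_)
import Relation.Binary.Reasoning.Setoid as SetoidReasoning
open import Relation.Nullary.Decidable using (Dec; yes; no; map′; ¬?; _×-dec_; decidable-stable)
open import Relation.Nullary.Negation using (¬_; contradiction)

open CommutativeMonoidSum ℕ.+-0-commutativeMonoid using () renaming
  (sum to sumℕ; sum-permute to sumℕ-permute; sum-cong-≗ to sumℕ-cong)

-- Counting permutations, sums of natural numbers, and binomial coefficients modulo a prime.

module _ where
  open import Data.Nat.Base using (_!; _+_; _*_; _^_; _<_; _≤_)
  open ≡ using (refl; sym; trans; cong; cong₂; subst; module ≡-Reasoning)

  funToFin-cong : ∀ {m n} {f g : Fin m → Fin n} → f ≗ g → funToFin f ≡ funToFin g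
  funToFin-cong {zero}  f≗g = refl
  funToFin-cong {suc m} f≗g = cong₂ combine (f≗g zero) (funToFin-cong (f≗g ∘ suc))

  finToFun-injective : ∀ m n {c d : Fin (m ^ n)} →
                       finToFun {m} {n} c ≗ finToFun {m} {n} d → c ≡ d
  finToFun-injective m n {c} {d} c≗d = begin
    c                              ≡⟨ Fin.funToFin-finToFin {n} {m} c ⟨
    funToFin (finToFun {m} {n} c)  ≡⟨ funToFin-cong c≗d ⟩
    funToFin (finToFun {m} {n} d)  ≡⟨ Fin.funToFin-finToFin {n} {m} d ⟩
    d                              ∎
    where open ≡-Reasoning

  -- The factorial number system (Lehmer code): the leading digit is the image of `zero`, and the
  -- remainder codes a permutation of the other points.
  nthPermutation : ∀ n → Fin (n !) → Permutation′ n
  nthPermutation zero    c = Perm.id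
  nthPermutation (suc n) c =
    Perm.insert zero (quotient {suc n} (n !) c) (nthPermutation n (remainder {suc n} (n !) c))

  -- The value at `zero` recovers the leading digit. Once these digits agree, the same `punchIn` can
  -- be cancelled at all other points, which leaves the permutations coded by the remainders.
  nthPermutation-injective : ∀ n {c d} → nthPermutation n c Perm.≈ nthPermutation n d → c ≡ d
  nthPermutation-injective zero    {zero} {zero} _ = refl
  nthPermutation-injective (suc n) {c} {d} c≈d = begin
    c                                           ≡⟨ Fin.combine-remQuot {suc n} (n !) c ⟨
    combine (quot c) (rem c)  ≡⟨ cong₂ combine quot≡ rem≡ ⟩
    combine (quot d) (rem d)  ≡⟨ Fin.combine-remQuot {suc n} (n !) d ⟩
    d                                           ∎
    where
    open ≡-Reasoning
    quot = quotient {suc n} (n !)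
    rem  = remainder {suc n} (n !)
    quot≡ : quot c ≡ quot d
    quot≡ = c≈d zero
    rem≡ : rem c ≡ rem d
    rem≡ = nthPermutation-injective n λ i → Fin.punchIn-injective (quot d) _ _
      (trans (cong (λ j → punchIn j (nthPermutation n (rem c) ⟨$⟩ʳ i)) (sym quot≡)) (c≈d (suc i)))

  sumℕ-mono-≤ : ∀ {n} {f g : Fin n → ℕ} → (∀ i → f i ≤ g i) → sumℕ f ≤ sumℕ g
  sumℕ-mono-≤ {zero}  f≤g = ℕ.≤-refl
  sumℕ-mono-≤ {suc n} f≤g = ℕ.+-mono-≤ (f≤g zero) (sumℕ-mono-≤ (f≤g ∘ suc))

  sumℕ-mono-< : ∀ {n} {f g : Fin n → ℕ} → (∀ i → f i ≤ g i) → ∀ i → f i < g i → sumℕ f < sumℕ g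
  sumℕ-mono-< f≤g zero    f<g = ℕ.+-mono-<-≤ f<g (sumℕ-mono-≤ (f≤g ∘ suc))
  sumℕ-mono-< f≤g (suc i) f<g = ℕ.+-mono-≤-< (f≤g zero) (sumℕ-mono-< (f≤g ∘ suc) i f<g)

  -- Induction through Pascal's rule, applied to both sides. It exhibits `suc n` as a divisor of a
  -- multiple of the binomial coefficient.
  absorption : ∀ n k → suc k * (suc n C suc k) ≡ suc n * (n C k)
  absorption zero    zero    = refl
  absorption zero    (suc k) = ℕ.*-zeroʳ (suc (suc k))
  absorption (suc n) zero    = trans (ℕ.+-identityʳ _) (trans (nC1≡n (suc (suc n))) (sym (ℕ.*-identityʳ _)))
  absorption (suc n) (suc k) = begin
    suc (suc k) * (suc (suc n) C suc (suc k))
      ≡⟨ cong (suc (suc k) *_) (nCk+nC[k+1]≡[n+1]C[k+1] (suc n) (suc k)) ⟨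
    suc (suc k) * (a + b)
      ≡⟨ distr (suc k) a b ⟩
    a + (suc k * a + suc (suc k) * b)
      ≡⟨ cong (a +_) (cong₂ _+_ (absorption n k) (absorption n (suc k))) ⟩
    a + (suc n * (n C k) + suc n * (n C suc k))
      ≡⟨ cong (a +_) (ℕ.*-distribˡ-+ (suc n) (n C k) (n C suc k)) ⟨
    a + suc n * (n C k + n C suc k)
      ≡⟨ cong (λ z → a + suc n * z) (nCk+nC[k+1]≡[n+1]C[k+1] n k) ⟩
    suc (suc n) * a ∎
    where
    open ≡-Reasoning
    a = suc n C suc k
    b = suc n C suc (suc k)
    distr : ∀ k a b → suc k * (a + b) ≡ a + (k * a + suc k * b)
    distr = solve-∀

  -- By `absorption`, `p` divides the product of `suc k` and the coefficient. It is too large to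
  -- divide `suc k`, so Euclid's lemma leaves the coefficient.
  prime∣binomial : ∀ {p} → Prime p → ∀ k → suc k < p → p ∣ p C suc k
  prime∣binomial {suc n} p-prime k k<p
    with euclidsLemma (suc k) (suc n C suc k) p-prime
           (subst (suc n ∣_) (sym (trans (absorption n k) (ℕ.*-comm (suc n) (n C k)))) (n∣m*n (n C k)))
  ... | inj₁ p∣k = contradiction (∣⇒≤ p∣k) (ℕ.<⇒≱ k<p)
  ... | inj₂ p∣C = p∣C

-- Sums in a commutative monoid with a single exceptional term.

module _ {c ℓ} (M : CommutativeMonoid c ℓ) where
  open CommutativeMonoid M
  open CommutativeMonoidSum M using (sum; sum-remove; sum-cong-≋; sum-replicate)
  open MonoidMult monoid using () renaming (_×_ to _·_)
  open SetoidReasoning setoid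

  -- The additional `x` on the left takes the place of the exceptional term, so exactly `n` copies
  -- appear and neither inverses nor `n - 1` are involved. It serves once for products and once for
  -- sums.
  sum-except : ∀ {n} {t : Fin n → Carrier} {x} (i : Fin n) → (∀ j → j ≢ i → t j ≈ x) →
               x ∙ sum t ≈ t i ∙ n · x
  sum-except {suc n} {t} {x} i t≈x = begin
    x ∙ sum t                         ≈⟨ ∙-congˡ (sum-remove {i = i} t) ⟩
    x ∙ (t i ∙ sum (removeAt t i))
      ≈⟨ ∙-congˡ (∙-congˡ (sum-cong-≋ λ j → t≈x (punchIn i j) (Fin.punchInᵢ≢i i j))) ⟩
    x ∙ (t i ∙ sum (replicate n x))   ≈⟨ ∙-congˡ (∙-congˡ (sum-replicate n)) ⟩
    x ∙ (t i ∙ n · x)                 ≈⟨ assoc x (t i) (n · x) ⟨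
    (x ∙ t i) ∙ n · x                 ≈⟨ ∙-congʳ (comm x (t i)) ⟩
    (t i ∙ x) ∙ n · x                 ≈⟨ assoc (t i) x (n · x) ⟩
    t i ∙ suc n · x                   ∎

-- Finite fields: enumeration, cancellation, and some explicit bijections.

module FiniteFieldProperties {c ℓ m} (F : FiniteField c ℓ m) where
  open FiniteField F hiding (zero)
  open GroupProperties +-group using (x∙y⁻¹≈ε⇒x≈y; x≈y⇒x∙y⁻¹≈ε; ε⁻¹≈ε; identityʳ-unique; ∙-cancelˡ; ∙-cancelʳ)
  open RingProperties ring using (-1*x≈-x)
  open SemiringSum semiring
  open Mult semiring using (×1-homo-*; ×-assoc-*; ×-assocˡ; ×-congˡ; ×-congʳ; ×-homo-1) renaming (_×_ to _·_)
  open Exp commutativeSemiring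
  open CommutativeMonoidSum *-commutativeMonoid using () renaming
    (sum to product; sum-cong-≋ to product-cong; ∑-distrib-+ to product-distrib-*; sum-permute to product-permute)
  open SemiringSolver commutativeSemiring using (solve; _:=_; _:+_; _:*_)
  open SetoidReasoning setoid

  open Inverse finite using () renaming
    (to to index; from to elt; to-cong to index-cong; strictlyInverseˡ to index-elt; strictlyInverseʳ to elt-index) public

  index-injective : ∀ {x y} → index x ≡ index y → x ≈ y
  index-injective {x} {y} eq = trans (sym (elt-index x)) (trans (reflexive (≡.cong elt eq)) (elt-index y))

  elt-injective : ∀ {i j} → elt i ≈ elt j → i ≡ j
  elt-injective {i} {j} eq = ≡.trans (≡.sym (index-elt i)) (≡.trans (index-cong eq) (index-elt j))

  infix 4 _≟_
  _≟_ : ∀ x y → Dec (x ≈ y)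
  x ≟ y = map′ index-injective index-cong (index x Fin.≟ index y)

  1<size : 1 ℕ.< m
  1<size = distinct⇒1< (index 1#) (index 0#) (1≉0 ∘ index-injective)
    where
    distinct⇒1< : ∀ {n} (i j : Fin n) → i ≢ j → 1 ℕ.< n
    distinct⇒1< {suc zero}    zero zero i≢j = contradiction ≡.refl i≢j
    distinct⇒1< {suc (suc n)} _    _    _   = s≤s (s≤s z≤n)

  x≈y+[x-y] : ∀ x y → x ≈ y + (x - y)
  x≈y+[x-y] x y = begin
    x              ≈⟨ +-identityʳ x ⟨
    x + 0#         ≈⟨ +-congˡ (-‿inverseˡ y) ⟨
    x + (- y + y)  ≈⟨ +-assoc x (- y) y ⟨
    (x - y) + y    ≈⟨ +-comm (x - y) y ⟩
    y + (x - y)    ∎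

  *-cancelˡ : ∀ {x y z} → x ≉ 0# → x * y ≈ x * z → y ≈ z
  *-cancelˡ {x} {y} {z} x≉0 xy≈xz with inverse x x≉0
  ... | x⁻¹ , xx⁻¹≈1 = trans (sym (absorb y)) (trans (*-congˡ xy≈xz) (absorb z))
    where
    absorb : ∀ w → x⁻¹ * (x * w) ≈ w
    absorb w = begin
      x⁻¹ * (x * w)  ≈⟨ *-assoc x⁻¹ x w ⟨
      x⁻¹ * x * w    ≈⟨ *-congʳ (trans (*-comm x⁻¹ x) xx⁻¹≈1) ⟩
      1# * w         ≈⟨ *-identityˡ w ⟩
      w              ∎

  *-nonzero : ∀ {x y} → x ≉ 0# → y ≉ 0# → x * y ≉ 0#
  *-nonzero {x} x≉0 y≉0 xy≈0 = y≉0 (*-cancelˡ x≉0 (trans xy≈0 (sym (zeroʳ x))))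

  toPermutation : ∀ {f} → Bijective _≈_ _≈_ f → Permutation′ m
  toPermutation {f} (inj , surj) = Perm.permutation
    (λ i → index (f (elt i)))
    (λ j → index (proj₁ (surj (elt j))))
    (λ j → ≡.trans (index-cong (proj₂ (surj (elt j)) (elt-index _))) (index-elt j))
    (λ i → ≡.trans (index-cong (inj (trans (proj₂ (surj _) refl) (elt-index _)))) (index-elt i))

  +-bijective : ∀ a → Bijective _≈_ _≈_ (_+ a)
  +-bijective a = (λ {x} {y} → ∙-cancelʳ a x y) , λ y → y - a ,
    λ z≈y-a → trans (+-congʳ z≈y-a) (trans (+-comm (y - a) a) (sym (x≈y+[x-y] y a)))

  *-bijective : ∀ {a} → a ≉ 0# → Bijective _≈_ _≈_ (a *_)
  *-bijective {a} a≉0 with inverse a a≉0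
  ... | a⁻¹ , aa⁻¹≈1 = *-cancelˡ a≉0 , λ y → a⁻¹ * y , λ {z} z≈a⁻¹y → begin
    a * z          ≈⟨ *-congˡ z≈a⁻¹y ⟩
    a * (a⁻¹ * y)  ≈⟨ *-assoc a a⁻¹ y ⟨
    a * a⁻¹ * y    ≈⟨ *-congʳ aa⁻¹≈1 ⟩
    1# * y         ≈⟨ *-identityˡ y ⟩
    y              ∎

  Bijective-≈ : ∀ {f g} → (∀ x → f x ≈ g x) → Bijective _≈_ _≈_ f → Bijective _≈_ _≈_ g
  Bijective-≈ f≈g (inj , surj) =
    (λ eq → inj (trans (f≈g _) (trans eq (sym (f≈g _))))) ,
    (λ y → proj₁ (surj y) , λ eq → trans (sym (f≈g _)) (proj₂ (surj y) eq))

  swap : Carrier → Carrier → Carrier → Carrier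
  swap a b x with x ≟ a | x ≟ b
  ... | yes _ | _     = b
  ... | no _  | yes _ = a
  ... | no _  | no _  = x

  swap-left : ∀ a b {x} → x ≈ a → swap a b x ≈ b
  swap-left a b {x} x≈a with x ≟ a | x ≟ b
  ... | yes _  | _ = refl
  ... | no x≉a | _ = contradiction x≈a x≉a

  swap-right : ∀ a b {x} → x ≈ b → swap a b x ≈ a
  swap-right a b {x} x≈b with x ≟ a | x ≟ b
  ... | yes x≈a | _      = trans (sym x≈b) x≈a
  ... | no _    | yes _  = refl
  ... | no _    | no x≉b = contradiction x≈b x≉b

  swap-other : ∀ a b {x} → x ≉ a → x ≉ b → swap a b x ≈ x
  swap-other a b {x} x≉a x≉b with x ≟ a | x ≟ b
  ... | yes x≈a | _       = contradiction x≈a x≉a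
  ... | no _    | yes x≈b = contradiction x≈b x≉b
  ... | no _    | no _    = refl

  swap-cong : ∀ a b {x y} → x ≈ y → swap a b x ≈ swap a b y
  swap-cong a b {x} {y} x≈y with x ≟ a | x ≟ b
  ... | yes x≈a | _       = sym (swap-left a b (trans (sym x≈y) x≈a))
  ... | no _    | yes x≈b = sym (swap-right a b (trans (sym x≈y) x≈b))
  ... | no x≉a  | no x≉b  = trans x≈y (sym (swap-other a b (x≉a ∘ trans x≈y) (x≉b ∘ trans x≈y)))

  swap-involutive : ∀ a b x → swap a b (swap a b x) ≈ x
  swap-involutive a b x with x ≟ a | x ≟ b
  ... | yes x≈a | _       = trans (swap-right a b refl) (sym x≈a)
  ... | no _    | yes x≈b = trans (swap-left a b refl) (sym x≈b)
  ... | no x≉a  | no x≉b  = swap-other a b x≉a x≉b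

  swap-bijective : ∀ a b → Bijective _≈_ _≈_ (swap a b)
  swap-bijective a b =
    (λ {x} {y} eq → trans (sym (swap-involutive a b x)) (trans (swap-cong a b eq) (swap-involutive a b y))) ,
    (λ y → swap a b y , λ eq → trans (swap-cong a b eq) (swap-involutive a b y))

  -- Fermat's little theorem in a finite field.

  -- The product of all nonzero elements is unchanged when each of them is
  -- multiplied by x; the zero element is made to contribute 1.
  private
    ifZero : ∀ y → Carrier → Carrier → Carrier
    ifZero y a b with y ≟ 0#
    ... | yes _ = a
    ... | no  _ = b

    ifZero-yes : ∀ {y a b} → y ≈ 0# → ifZero y a b ≈ a
    ifZero-yes {y} y≈0 with y ≟ 0#
    ... | yes _  = refl
    ... | no y≉0 = contradiction y≈0 y≉0

    ifZero-no : ∀ {y a b} → y ≉ 0# → ifZero y a b ≈ b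
    ifZero-no {y} y≉0 with y ≟ 0#
    ... | yes y≈0 = contradiction y≈0 y≉0
    ... | no _    = refl

    nonzeroPart : Carrier → Carrier
    nonzeroPart y = ifZero y 1# y

    nonzeroPart-nonzero : ∀ y → nonzeroPart y ≉ 0#
    nonzeroPart-nonzero y with y ≟ 0#
    ... | yes _  = 1≉0
    ... | no y≉0 = y≉0

    nonzeroPart-cong : ∀ {y z} → y ≈ z → nonzeroPart y ≈ nonzeroPart z
    nonzeroPart-cong {y} {z} y≈z with y ≟ 0#
    ... | yes y≈0 = sym (ifZero-yes (trans (sym y≈z) y≈0))
    ... | no  y≉0 = trans y≈z (sym (ifZero-no (y≉0 ∘ trans y≈z)))

    nonzeroPart-* : ∀ {x} → x ≉ 0# → ∀ y → nonzeroPart (x * y) ≈ ifZero y 1# x * nonzeroPart y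
    nonzeroPart-* {x} x≉0 y with y ≟ 0#
    ... | yes y≈0 = trans (ifZero-yes (trans (*-congˡ y≈0) (zeroʳ x))) (sym (*-identityˡ 1#))
    ... | no  y≉0 = ifZero-no (*-nonzero x≉0 y≉0)

    product-nonzero : ∀ {n} {t : Fin n → Carrier} → (∀ i → t i ≉ 0#) → product t ≉ 0#
    product-nonzero {zero}  t≉0 = 1≉0
    product-nonzero {suc n} t≉0 = *-nonzero (t≉0 zero) (product-nonzero (t≉0 ∘ suc))

  0^n≈0 : ∀ {n} → 0 ℕ.< n → 0# ^ n ≈ 0#
  0^n≈0 {suc n} _ = zeroˡ (0# ^ n)

  x^size≈x : ∀ x → x ^ m ≈ x
  x^size≈x x with x ≟ 0#
  ... | yes x≈0 = trans (^-congˡ m x≈0) (trans (0^n≈0 (ℕ.<⇒≤ 1<size)) (sym x≈0))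
  ... | no  x≉0 = begin
    x ^ m                                ≈⟨ *-identityˡ (x ^ m) ⟨
    1# * x ^ m                           ≈⟨ *-congʳ (ifZero-yes (elt-index 0#)) ⟨
    ifZero (elt (index 0#)) 1# x * x ^ m
      -- `units` is 1 at the index of zero and `x` at every other index, so the extra factor `x`
      -- completes its product to `x ^ m`.
      ≈⟨ sum-except *-commutativeMonoid (index 0#) (λ j j≢0 → ifZero-no λ eltj≈0 →
                                              j≢0 (≡.trans (≡.sym (index-elt j)) (index-cong eltj≈0))) ⟨
    x * product units
      ≈⟨ *-congˡ (*-cancelˡ (product-nonzero (nonzeroPart-nonzero ∘ elt)) product-units) ⟩
    x * 1#                               ≈⟨ *-identityʳ x ⟩
    x                                    ∎
    where
    units : Fin m → Carrier
    units i = ifZero (elt i) 1# x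

    nonzeros : Fin m → Carrier
    nonzeros = nonzeroPart ∘ elt

    product-units : product nonzeros * product units ≈ product nonzeros * 1#
    product-units = begin
      product nonzeros * product units               ≈⟨ *-comm _ _ ⟩
      product units * product nonzeros               ≈⟨ product-distrib-* units nonzeros ⟨
      product (λ i → units i * nonzeros i)           ≈⟨ product-cong (λ i → nonzeroPart-* x≉0 (elt i)) ⟨
      product (λ i → nonzeroPart (x * elt i))
        ≈⟨ product-cong (λ i → nonzeroPart-cong (elt-index (x * elt i))) ⟨
      product (λ i → nonzeros (index (x * elt i)))
        ≈⟨ product-permute nonzeros (toPermutation (*-bijective x≉0)) ⟨
      product nonzeros                               ≈⟨ *-identityʳ _ ⟨
      product nonzeros * 1#                          ∎

  x^[size-1]≈1 : ∀ {x} → x ≉ 0# → x ^ pred m ≈ 1#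
  x^[size-1]≈1 {x} x≉0 = *-cancelˡ x≉0 (begin
    x * x ^ pred m    ≡⟨ ≡.cong (x ^_) (ℕ.suc-pred m {{ℕ.>-nonZero (ℕ.<⇒≤ 1<size)}}) ⟩
    x ^ m             ≈⟨ x^size≈x x ⟩
    x                 ≈⟨ *-identityʳ x ⟨
    x * 1#            ∎)

  -- The characteristic and the Frobenius map.

  n·0≈0 : ∀ n → n · 0# ≈ 0#
  n·0≈0 n = trans (sym (sum-replicate n)) (sum-replicate-zero n)

  -- Translation by 1 permutes the field, so adding 1 to each of the `m` elements does not change
  -- their sum.
  size·1≈0 : m · 1# ≈ 0#
  size·1≈0 = identityʳ-unique (sum elt) (m · 1#) (begin
    sum elt + m · 1#                  ≈⟨ +-congˡ (sum-replicate m) ⟨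
    sum elt + sum (replicate m 1#)    ≈⟨ ∑-distrib-+ elt (replicate m 1#) ⟨
    sum (λ i → elt i + 1#)            ≈⟨ sum-cong-≋ (λ i → elt-index (elt i + 1#)) ⟨
    sum (λ i → elt (index (elt i + 1#))) ≈⟨ sum-permute elt (toPermutation (+-bijective 1#)) ⟨
    sum elt                           ∎)

  -- Some power of `p` annihilates 1. As long as `p · 1#` is nonzero, one factor `p` can be
  -- cancelled from that power; cancelling all of them would give 1 = 0.
  p·1≈0 : ∀ p e → m ≡ p ℕ.^ e → p · 1# ≈ 0#
  p·1≈0 p e m≡p^e = go e (trans (×-congˡ {1#} (≡.sym m≡p^e)) size·1≈0)
    where
    go : ∀ e → (p ℕ.^ e) · 1# ≈ 0# → p · 1# ≈ 0#
    go zero    1≈0 = contradiction (trans (sym (×-homo-1 1#)) 1≈0) 1≉0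
    go (suc e) eq with (p · 1#) ≟ 0#
    ... | yes p≈0 = p≈0
    ... | no  p≉0 = go e (*-cancelˡ p≉0 (trans (sym (×1-homo-* p (p ℕ.^ e))) (trans eq (sym (zeroʳ _)))))

  -- Only the two extreme terms of the binomial expansion survive: the inner coefficients are
  -- multiples of `p`, and `p` annihilates the field.
  frobenius : ∀ {p} → Prime p → p · 1# ≈ 0# → ∀ x y → (x + y) ^ p ≈ x ^ p + y ^ p
  frobenius {zero} p-prime _ _ _ = contradiction p-prime ¬prime[0]
  frobenius {p@(suc r)} p-prime p≈0 x y = begin
    (x + y) ^ p                                 ≈⟨ Binomial.theorem commutativeSemiring p x y ⟩
    term zero + sum (term ∘ suc)                ≈⟨ +-congˡ (sum-init-last (term ∘ suc)) ⟩
    term zero + (sum (init (term ∘ suc)) + term (suc (fromℕ r)))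
      ≈⟨ +-cong first (+-cong (trans (sum-cong-≋ middle) (sum-replicate-zero r)) final) ⟩
    y ^ p + (0# + x ^ p)                        ≈⟨ +-congˡ (+-identityˡ _) ⟩
    y ^ p + x ^ p                               ≈⟨ +-comm _ _ ⟩
    x ^ p + y ^ p                               ∎
    where
    power : Fin (suc p) → Carrier
    power k = x ^ toℕ k * y ^ (p ℕ.∸ toℕ k)

    term : Fin (suc p) → Carrier
    term k = (p C toℕ k) · power k

    first : term zero ≈ y ^ p
    first = trans (×-homo-1 _) (*-identityˡ _)

    multiple-of-p : ∀ {j} z → p ∣ j → j · z ≈ 0#
    multiple-of-p z (divides j ≡.refl) = begin
      (j ℕ.* p) · z        ≈⟨ ×-assocˡ z j p ⟨
      j · (p · z)          ≈⟨ ×-congʳ j (×-congʳ p (*-identityˡ z)) ⟨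
      j · (p · (1# * z))   ≈⟨ ×-congʳ j (×-assoc-* p 1# z) ⟨
      j · (p · 1# * z)     ≈⟨ ×-congʳ j (trans (*-congʳ p≈0) (zeroˡ z)) ⟩
      j · 0#               ≈⟨ n·0≈0 j ⟩
      0#                   ∎

    middle : ∀ i → init (term ∘ suc) i ≈ 0#
    -- `init` drops the last term, which keeps the binomial index strictly between 0 and `p`.
    middle i = multiple-of-p _ (prime∣binomial p-prime (toℕ (inject₁ i))
      (s≤s (≡.subst (ℕ._< r) (≡.sym (Fin.toℕ-inject₁ i)) (Fin.toℕ<n i))))

    final : term (suc (fromℕ r)) ≈ x ^ p
    final rewrite Fin.toℕ-fromℕ r | nCn≡1 p | ℕ.n∸n≡0 r = trans (×-homo-1 _) (*-identityʳ _)

  frobenius-^ : ∀ {p} → Prime p → p · 1# ≈ 0# → ∀ k x y →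
                (x + y) ^ (p ℕ.^ k) ≈ x ^ (p ℕ.^ k) + y ^ (p ℕ.^ k)
  frobenius-^ _ _ zero x y = trans (*-identityʳ _) (sym (+-cong (*-identityʳ x) (*-identityʳ y)))
  frobenius-^ {p} p-prime p≈0 (suc k) x y = begin
    (x + y) ^ (p ℕ.* p ℕ.^ k)                      ≈⟨ ^-assocʳ (x + y) p (p ℕ.^ k) ⟨
    ((x + y) ^ p) ^ (p ℕ.^ k)                      ≈⟨ ^-congˡ (p ℕ.^ k) (frobenius p-prime p≈0 x y) ⟩
    (x ^ p + y ^ p) ^ (p ℕ.^ k)                    ≈⟨ frobenius-^ p-prime p≈0 k (x ^ p) (y ^ p) ⟩
    (x ^ p) ^ (p ℕ.^ k) + (y ^ p) ^ (p ℕ.^ k)      ≈⟨ +-cong (^-assocʳ x p (p ℕ.^ k)) (^-assocʳ y p (p ℕ.^ k)) ⟩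
    x ^ (p ℕ.* p ℕ.^ k) + y ^ (p ℕ.* p ℕ.^ k)      ∎

  -- Polynomial maps, their degrees and roots, and interpolation.

  -- Degrees are tracked on functions in Horner form, not on coefficient lists.
  Deg< : ℕ → (Carrier → Carrier) → Set (c ⊔ ℓ)
  Deg< zero    f = ∀ x → f x ≈ 0#
  Deg< (suc d) f = ∃[ a ] Σ[ g ∈ (Carrier → Carrier) ] Deg< d g × (∀ x → f x ≈ a + x * g x)

  -- One map can be monic in several degrees, since `x` and `x ^ m` agree on the field. The
  -- existence of such a presentation is enough for counting roots.
  Monic : ℕ → (Carrier → Carrier) → Set (c ⊔ ℓ)
  Monic zero    f = ∀ x → f x ≈ 1#
  Monic (suc d) f = ∃[ a ] Σ[ g ∈ (Carrier → Carrier) ] Monic d g × (∀ x → f x ≈ a + x * g x)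

  Deg<-cong : ∀ d {f g} → (∀ x → f x ≈ g x) → Deg< d f → Deg< d g
  Deg<-cong zero    f≈g f≈0            = λ x → trans (sym (f≈g x)) (f≈0 x)
  Deg<-cong (suc d) f≈g (a , h , H , e) = a , h , H , λ x → trans (sym (f≈g x)) (e x)

  Deg<-0 : ∀ d → Deg< d (λ _ → 0#)
  Deg<-0 zero    = λ _ → refl
  Deg<-0 (suc d) = 0# , (λ _ → 0#) , Deg<-0 d , λ x → sym (trans (+-identityˡ _) (zeroʳ x))

  Deg<-≤ : ∀ {d e f} → d ℕ.≤ e → Deg< d f → Deg< e f
  Deg<-≤ {e = e} z≤n F                  = Deg<-cong e (sym ∘ F) (Deg<-0 e)
  Deg<-≤ (s≤s d≤e) (a , g , G , e) = a , g , Deg<-≤ d≤e G , e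

  Deg<-+ : ∀ d {f g} → Deg< d f → Deg< d g → Deg< d (λ x → f x + g x)
  Deg<-+ zero F G = λ x → trans (+-cong (F x) (G x)) (+-identityˡ 0#)
  Deg<-+ (suc d) (a , f , F , p) (b , g , G , q) =
    a + b , (λ x → f x + g x) , Deg<-+ d F G , λ x → trans (+-cong (p x) (q x))
      (solve 5 (λ a b x f g → (a :+ x :* f) :+ (b :+ x :* g) := (a :+ b) :+ x :* (f :+ g)) refl a b x (f x) (g x))

  Deg<-scale : ∀ d c {f} → Deg< d f → Deg< d (λ x → c * f x)
  Deg<-scale zero c F = λ x → trans (*-congˡ (F x)) (zeroʳ c)
  Deg<-scale (suc d) c (a , f , F , p) =
    c * a , (λ x → c * f x) , Deg<-scale d c F , λ x → trans (*-congˡ (p x))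
      (solve 4 (λ a c x f → c :* (a :+ x :* f) := c :* a :+ x :* (c :* f)) refl a c x (f x))

  Deg<-const : ∀ a → Deg< 1 (λ _ → a)
  Deg<-const a = a , (λ _ → 0#) , Deg<-0 0 , λ x → sym (trans (+-congˡ (zeroʳ x)) (+-identityʳ a))

  Deg<-shift : ∀ d {f} → Deg< d f → Deg< (suc d) (λ x → x * f x)
  Deg<-shift d {f} F = 0# , f , F , λ x → sym (+-identityˡ _)

  Deg<-x^ : ∀ d → Deg< (suc d) (_^ d)
  Deg<-x^ zero    = Deg<-const 1#
  Deg<-x^ (suc d) = Deg<-shift (suc d) (Deg<-x^ d)

  Deg<-[x+a]^ : ∀ a d → Deg< (suc d) (λ x → (x + a) ^ d)
  Deg<-[x+a]^ a zero    = Deg<-const 1#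
  Deg<-[x+a]^ a (suc d) = Deg<-cong (suc (suc d)) (λ x → sym (distribʳ ((x + a) ^ d) x a))
    (Deg<-+ (suc (suc d)) (Deg<-shift (suc d) D) (Deg<-≤ (ℕ.n≤1+n _) (Deg<-scale (suc d) a D)))
    where D = Deg<-[x+a]^ a d

  Deg<-sum : ∀ d {n} {f : Fin n → Carrier → Carrier} → (∀ i → Deg< d (f i)) → Deg< d (λ x → sum (λ i → f i x))
  Deg<-sum d {zero}  F = Deg<-0 d
  Deg<-sum d {suc n} F = Deg<-+ d (F zero) (Deg<-sum d (F ∘ suc))

  Monic-x^ : ∀ d → Monic d (_^ d)
  Monic-x^ zero    = λ _ → refl
  Monic-x^ (suc d) = 0# , (_^ d) , Monic-x^ d , λ x → sym (+-identityˡ _)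

  Deg<+Monic : ∀ d {f g} → Deg< d f → Monic d g → Monic d (λ x → f x + g x)
  Deg<+Monic zero F G = λ x → trans (+-cong (F x) (G x)) (+-identityˡ 1#)
  Deg<+Monic (suc d) (a , f , F , p) (b , g , G , q) =
    a + b , (λ x → f x + g x) , Deg<+Monic d F G , λ x → trans (+-cong (p x) (q x))
      (solve 5 (λ a b x f g → (a :+ x :* f) :+ (b :+ x :* g) := (a :+ b) :+ x :* (f :+ g)) refl a b x (f x) (g x))

  -- Division by x - r, written with s = x - r to avoid subtraction.
  Monic-divide : ∀ d {f} → Monic (suc d) f → ∀ r →
                 Σ[ g ∈ (Carrier → Carrier) ] Monic d g × (∀ {x} s → x ≈ r + s → f x ≈ f r + s * g x)
  Monic-divide zero {f} (a , g , G , p) r = g , G , λ {x} s x≈r+s → begin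
    f x                     ≈⟨ p x ⟩
    a + x * g x             ≈⟨ +-congˡ (*-congʳ x≈r+s) ⟩
    a + (r + s) * g x
      ≈⟨ solve 4 (λ a r s g → a :+ (r :+ s) :* g := (a :+ r :* g) :+ s :* g) refl a r s (g x) ⟩
    (a + r * g x) + s * g x ≈⟨ +-congʳ (+-congˡ (*-congˡ (trans (G x) (sym (G r))))) ⟩
    (a + r * g r) + s * g x ≈⟨ +-congʳ (p r) ⟨
    f r + s * g x           ∎
  Monic-divide (suc d) {f} (a , g , G , p) r with Monic-divide d G r
  ... | h , H , q = (λ x → g r + x * h x) , (g r , h , H , λ _ → refl) , λ {x} s x≈r+s → begin
    f x                                       ≈⟨ p x ⟩
    a + x * g x                               ≈⟨ +-congˡ (*-cong x≈r+s (q s x≈r+s)) ⟩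
    a + (r + s) * (g r + s * h x)
      ≈⟨ solve 5 (λ a r s g h → a :+ (r :+ s) :* (g :+ s :* h) := (a :+ r :* g) :+ s :* (g :+ (r :+ s) :* h)) refl a r s (g r) (h x) ⟩
    (a + r * g r) + s * (g r + (r + s) * h x) ≈⟨ +-cong (p r) (*-congˡ (+-congˡ (*-congʳ x≈r+s))) ⟨
    f r + s * (g r + x * h x)                 ∎

  -- The bound of `d` on the number of roots, in positive form. If the first point is a root, it is
  -- divided out; the quotient has a nonroot among the remaining points, where the linear factor is
  -- nonzero because the points are distinct.
  Monic⇒nonroot : ∀ d {f} → Monic d f → (r : Fin (suc d) → Carrier) → (∀ {i j} → r i ≈ r j → i ≡ j) →
                  ∃[ i ] f (r i) ≉ 0#
  Monic⇒nonroot zero F r r-inj = zero , λ fr≈0 → 1≉0 (trans (sym (F _)) fr≈0)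
  Monic⇒nonroot (suc d) {f} F r r-inj with f (r zero) ≟ 0#
  ... | no fr≉0 = zero , fr≉0
  ... | yes fr≈0 with Monic-divide d F (r zero)
  ...   | g , G , p with Monic⇒nonroot d G (r ∘ suc) (Fin.suc-injective ∘ r-inj)
  ...     | i , gr≉0 = suc i , λ fri≈0 → *-nonzero s≉0 gr≉0 (begin
    (r (suc i) - r zero) * g (r (suc i))               ≈⟨ +-identityˡ _ ⟨
    0# + (r (suc i) - r zero) * g (r (suc i))          ≈⟨ +-congʳ fr≈0 ⟨
    f (r zero) + (r (suc i) - r zero) * g (r (suc i))  ≈⟨ p _ (x≈y+[x-y] (r (suc i)) (r zero)) ⟨
    f (r (suc i))                                      ≈⟨ fri≈0 ⟩
    0#                                                 ∎)
    where
    s≉0 : r (suc i) - r zero ≉ 0#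
    s≉0 s≈0 with r-inj (x∙y⁻¹≈ε⇒x≈y _ _ s≈0)
    ... | ()

  Deg<⇒coefficients : ∀ d {f} → Deg< d f →
                      Σ[ P ∈ List Carrier ] (∀ x → foldr (λ a r → a + x * r) 0# P ≈ f x)
  Deg<⇒coefficients zero F = List.[] , λ x → sym (F x)
  Deg<⇒coefficients (suc d) (a , g , G , p) with Deg<⇒coefficients d G
  ... | P , q = a List.∷ P , λ x → trans (+-congˡ (*-congˡ (q x))) (sym (p x))

  -- 1 - (x - y)^(m-1) is the indicator of x = y.
  interpolation : ∀ (f : Carrier → Carrier) → (∀ {x y} → x ≈ y → f x ≈ f y) →
                  Σ[ P ∈ List Carrier ] (∀ x → foldr (λ a r → a + x * r) 0# P ≈ f x)
  interpolation f f-cong = Deg<⇒coefficients m (Deg<-cong m interpolates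
      (Deg<-sum m λ i → Deg<-scale m (f (elt i))
        (Deg<-+ m (Deg<-≤ (ℕ.<⇒≤ 1<size) (Deg<-const 1#)) (Deg<-cong m (λ x → -1*x≈-x _) (Deg<-scale m (- 1#)
          (Deg<-≤ (ℕ.≤-reflexive (ℕ.suc-pred m {{ℕ.>-nonZero (ℕ.<⇒≤ 1<size)}})) (Deg<-[x+a]^ (- elt i) (pred m))))))))
    where
    δ : Carrier → Carrier → Carrier
    δ x y = 1# - (x - y) ^ pred m

    δ-diagonal : ∀ {x y} → x ≈ y → δ x y ≈ 1#
    δ-diagonal x≈y = begin
      1# - (_ - _) ^ pred m ≈⟨ +-congˡ (-‿cong (^-congˡ (pred m) (x≈y⇒x∙y⁻¹≈ε x≈y))) ⟩
      -- The exponent `pred m` has to be positive, since `0# ^ 0` would be 1; this is where `1<size`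
      -- enters.
      1# - 0# ^ pred m      ≈⟨ +-congˡ (-‿cong (0^n≈0 (ℕ.pred-mono-≤ 1<size))) ⟩
      1# - 0#               ≈⟨ +-congˡ ε⁻¹≈ε ⟩
      1# + 0#               ≈⟨ +-identityʳ 1# ⟩
      1#                    ∎

    δ-offDiagonal : ∀ {x y} → x ≉ y → δ x y ≈ 0#
    δ-offDiagonal x≉y = trans (+-congˡ (-‿cong (x^[size-1]≈1 (x≉y ∘ x∙y⁻¹≈ε⇒x≈y _ _)))) (-‿inverseʳ 1#)

    interpolates : ∀ x → sum (λ i → f (elt i) * δ x (elt i)) ≈ f x
    interpolates x = begin
      sum t                      ≈⟨ +-identityˡ _ ⟨
      0# + sum t
        ≈⟨ sum-except +-commutativeMonoid (index x) (λ j j≢ → trans (*-congˡ (δ-offDiagonal λ x≈eltj →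
                                      j≢ (≡.trans (≡.sym (index-elt j)) (index-cong (sym x≈eltj))))) (zeroʳ _)) ⟩
      t (index x) + m · 0#
        ≈⟨ +-cong (*-cong (f-cong (elt-index x)) (δ-diagonal (sym (elt-index x)))) (n·0≈0 m) ⟩
      f x * 1# + 0#              ≈⟨ +-identityʳ _ ⟩
      f x * 1#                   ≈⟨ *-identityʳ _ ⟩
      f x                        ∎
      where
      t : Fin m → Carrier
      t i = f (elt i) * δ x (elt i)

-- The trace: its values are exactly the elements of the small field.

module ExtensionProperties {c₁ ℓ₁ c₂ ℓ₂ q r} (E : FiniteFieldExtension c₁ ℓ₁ c₂ ℓ₂ q (suc r))
                           (q-primePower : IsPrimePower q) where
  open FiniteFieldExtension E
  open K hiding (zero)
  module kₚ = FiniteFieldProperties 𝔽q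
  open FiniteFieldProperties 𝔽qⁿ
  open RingMorphisms.IsRingMonomorphism ιmono using () renaming
    (⟦⟧-cong to ι-cong; injective to ι-injective; +-homo to ι-+; *-homo to ι-*; 0#-homo to ι-0; 1#-homo to ι-1)
  open GroupProperties +-group using (identityˡ-unique)
  open RingProperties ring using (-1*x≈-x)
  open Exp commutativeSemiring
  open SemiringSum semiring
  open SetoidReasoning setoid
  private module kExp = SemiringExp k.semiring

  ι-^ : ∀ a j → ι (a kExp.^ j) ≈ ι a ^ j
  ι-^ a zero    = ι-1
  ι-^ a (suc j) = trans (ι-* a (a kExp.^ j)) (*-congˡ (ι-^ a j))

  ι^q≈ι : ∀ a → ι a ^ q ≈ ι a
  ι^q≈ι a = trans (sym (ι-^ a q)) (ι-cong (kₚ.x^size≈x a))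

  ι^q^i≈ι : ∀ a i → ι a ^ (q ℕ.^ i) ≈ ι a
  ι^q^i≈ι a zero    = *-identityʳ (ι a)
  ι^q^i≈ι a (suc i) = begin
    ι a ^ (q ℕ.* q ℕ.^ i)  ≈⟨ ^-assocʳ (ι a) q (q ℕ.^ i) ⟨
    (ι a ^ q) ^ (q ℕ.^ i)  ≈⟨ ^-congˡ (q ℕ.^ i) (ι^q≈ι a) ⟩
    ι a ^ (q ℕ.^ i)        ≈⟨ ι^q^i≈ι a i ⟩
    ι a                    ∎

  Tr-cong : ∀ {x y} → x ≈ y → Tr x ≈ Tr y
  Tr-cong x≈y = sum-cong-≋ {suc r} λ i → ^-congˡ (q ℕ.^ toℕ i) x≈y

  Tr-homogeneous : ∀ a x → Tr (ι a * x) ≈ ι a * Tr x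
  Tr-homogeneous a x = begin
    Tr (ι a * x)
      ≈⟨ sum-cong-≋ {suc r} (λ i → trans (^-distrib-* (ι a) x (q ℕ.^ toℕ i)) (*-congʳ (ι^q^i≈ι a (toℕ i)))) ⟩
    sum {suc r} (λ i → ι a * x ^ (q ℕ.^ toℕ i))
      ≈⟨ *-distribˡ-sum {suc r} (ι a) (λ i → x ^ (q ℕ.^ toℕ i)) ⟨
    ι a * Tr x                                            ∎

  -- The `k`-fold iterate of Frobenius. That `p` annihilates the large field is read off from its
  -- size, which is again a power of `p`.
  ^q-+ : ∀ x y → (x + y) ^ q ≈ x ^ q + y ^ q
  ^q-+ x y = ≡.subst (λ e → (x + y) ^ e ≈ x ^ e + y ^ e) (≡.sym q≡p^k)
    (frobenius-^ p-prime (p·1≈0 p (k ℕ.* suc r) q^n≡p^kn) k x y)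
    where
    p = proj₁ q-primePower
    k = proj₁ (proj₂ q-primePower)
    p-prime = proj₁ (proj₂ (proj₂ q-primePower))
    q≡p^k = proj₂ (proj₂ (proj₂ (proj₂ q-primePower)))
    q^n≡p^kn = ≡.trans (≡.cong (ℕ._^ suc r) q≡p^k) (ℕ.^-*-assoc p k (suc r))

  ^q-sum : ∀ {l} (t : Vector Carrier l) → sum t ^ q ≈ sum (λ i → t i ^ q)
  ^q-sum {zero}  t = 0^n≈0 (ℕ.<⇒≤ kₚ.1<size)
  ^q-sum {suc l} t = trans (^q-+ _ _) (+-congˡ (^q-sum (t ∘ suc)))

  -- The map `_^ q` is additive and shifts the summands of the trace cyclically: the top one becomes
  -- `x` raised to the size of the field, which is `x` again.
  Tr^q≈Tr : ∀ x → Tr x ^ q ≈ Tr x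
  Tr^q≈Tr x = begin
    Tr x ^ q                                  ≈⟨ ^q-sum {suc r} (λ i → x ^ (q ℕ.^ toℕ i)) ⟩
    sum {suc r} (λ i → (x ^ (q ℕ.^ toℕ i)) ^ q)
      ≈⟨ sum-cong-≋ {suc r} (λ i → trans (^-assocʳ x (q ℕ.^ toℕ i) q) (^-congʳ x (ℕ.*-comm (q ℕ.^ toℕ i) q))) ⟩
    sum y                                     ≈⟨ sum-init-last y ⟩
    sum (init y) + y (fromℕ r)                ≈⟨ +-comm _ _ ⟩
    y (fromℕ r) + sum (init y)
      ≈⟨ +-cong wrap (sum-cong-≋ {r} λ i → ^-congʳ x (≡.cong (λ j → q ℕ.^ suc j) (Fin.toℕ-inject₁ i))) ⟩
    Tr x                                      ∎
    where
    y : Fin (suc r) → Carrier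
    y i = x ^ (q ℕ.^ suc (toℕ i))

    -- The target is `x ^ 1` because the first summand of `Tr x` has exponent `q ^ 0`, which reduces
    -- to 1.
    wrap : y (fromℕ r) ≈ x ^ 1
    wrap = trans (^-congʳ x (≡.cong (λ j → q ℕ.^ suc j) (Fin.toℕ-fromℕ r))) (trans (x^size≈x x) (sym (*-identityʳ x)))

  -- The q elements of the image of ι are already roots of X^q - X.
  x^q≈x⇒x∈ι : ∀ x → x ^ q ≈ x → ∃[ a ] ι a ≈ x
  x^q≈x⇒x∈ι x x^q≈x with Fin.any? (λ i → ι (kₚ.elt i) ≟ x)
  ... | yes (i , eq) = kₚ.elt i , eq
  ... | no x∉ι = contradiction (f-roots i) (proj₂ nonroot)
    where
    f : Carrier → Carrier
    -- The linear term is spelled as a multiple of `y ^ 1`, to which the degree lemmas apply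
    -- directly.
    f y = - 1# * (y * 1#) + y ^ q

    roots : Fin (suc q) → Carrier
    roots zero    = x
    roots (suc i) = ι (kₚ.elt i)

    roots-injective : ∀ {i j} → roots i ≈ roots j → i ≡ j
    roots-injective {zero}  {zero}  _  = ≡.refl
    roots-injective {zero}  {suc j} eq = contradiction (j , sym eq) x∉ι
    roots-injective {suc i} {zero}  eq = contradiction (i , eq) x∉ι
    roots-injective {suc i} {suc j} eq = ≡.cong suc (kₚ.elt-injective (ι-injective eq))

    -- Since `q` is at least 2, the linear term lies below the leading one. A further fixed point
    -- `x` outside the image would make `q + 1` distinct roots.
    nonroot = Monic⇒nonroot q {f} (Deg<+Monic q (Deg<-≤ kₚ.1<size (Deg<-scale 2 (- 1#) (Deg<-x^ 1))) (Monic-x^ q))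
                roots roots-injective
    i = proj₁ nonroot

    fixed⇒root : ∀ {y} → y ^ q ≈ y → f y ≈ 0#
    fixed⇒root {y} y^q≈y = begin
      - 1# * (y * 1#) + y ^ q  ≈⟨ +-cong (trans (*-congˡ (*-identityʳ y)) (-1*x≈-x y)) y^q≈y ⟩
      - y + y                  ≈⟨ -‿inverseˡ y ⟩
      0#                       ∎

    f-roots : ∀ i → f (roots i) ≈ 0#
    f-roots zero    = fixed⇒root x^q≈x
    f-roots (suc i) = fixed⇒root (ι^q≈ι _)

  Tr∈ι : ∀ x → ∃[ a ] ι a ≈ Tr x
  Tr∈ι x = x^q≈x⇒x∈ι (Tr x) (Tr^q≈Tr x)

  -- Tr is a monic polynomial of degree q^r, less than the size of 𝔽qⁿ.
  Tr-nonzero : ∃[ x ] Tr x ≉ 0#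
  Tr-nonzero = x , λ Tr≈0 → proj₂ nonroot (trans (sym (sum-init-last (λ (i : Fin (suc r)) → x ^ (q ℕ.^ toℕ i)))) Tr≈0)
    where
    q^r<q^n : q ℕ.^ r ℕ.< q ℕ.^ suc r
    q^r<q^n = ℕ.^-monoʳ-< q kₚ.1<size (ℕ.n<1+n r)

    f : Carrier → Carrier
    -- The last summand is split off as the leading term; since `q > 1`, all other exponents are
    -- strictly smaller.
    f x = sum (λ i → x ^ (q ℕ.^ toℕ (inject₁ {r} i))) + x ^ (q ℕ.^ toℕ (fromℕ r))

    f-monic : Monic (q ℕ.^ r) f
    f-monic = Deg<+Monic (q ℕ.^ r)
      (Deg<-sum (q ℕ.^ r) λ i → Deg<-≤ (ℕ.^-monoʳ-< q kₚ.1<size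
        (≡.subst (ℕ._< r) (≡.sym (Fin.toℕ-inject₁ i)) (Fin.toℕ<n i))) (Deg<-x^ (q ℕ.^ toℕ (inject₁ i))))
      (≡.subst (λ j → Monic (q ℕ.^ r) (_^ (q ℕ.^ j))) (≡.sym (Fin.toℕ-fromℕ r)) (Monic-x^ (q ℕ.^ r)))

    nonroot = Monic⇒nonroot (q ℕ.^ r) f-monic (λ i → elt (inject≤ i q^r<q^n))
                (λ eq → Fin.inject≤-injective q^r<q^n q^r<q^n _ _ (elt-injective eq))
    x = elt (inject≤ (proj₁ nonroot) q^r<q^n)

  -- A nonzero trace comes from the small field, so homogeneity allows rescaling it to 1 by its
  -- inverse there.
  Tr-one : ∃[ x ] Tr x ≈ 1#
  Tr-one with Tr-nonzero
  ... | x , Tr≉0 with Tr∈ι x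
  ...   | b , ιb≈Tr with k.inverse b (λ b≈0 → Tr≉0 (trans (sym ιb≈Tr) (trans (ι-cong b≈0) ι-0)))
  ...     | b⁻¹ , bb⁻¹≈1 = ι b⁻¹ * x , (begin
    Tr (ι b⁻¹ * x)  ≈⟨ Tr-homogeneous b⁻¹ x ⟩
    ι b⁻¹ * Tr x    ≈⟨ *-comm _ _ ⟩
    Tr x * ι b⁻¹    ≈⟨ *-congʳ ιb≈Tr ⟨
    ι b * ι b⁻¹     ≈⟨ ι-* b b⁻¹ ⟨
    ι (b k.* b⁻¹)   ≈⟨ ι-cong bb⁻¹≈1 ⟩
    ι k.1#          ≈⟨ ι-1 ⟩
    1#              ∎)

  -- This right inverse of the trace lets any map into the small field be written as the trace of a
  -- map, which is how `H₁` will be found.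
  Tr-section : k.Carrier → Carrier
  Tr-section a = ι a * proj₁ Tr-one

  Tr-section-cong : ∀ {a b} → a k.≈ b → Tr-section a ≈ Tr-section b
  Tr-section-cong a≈b = *-congʳ (ι-cong a≈b)

  Tr-Tr-section : ∀ a → Tr (Tr-section a) ≈ ι a
  Tr-Tr-section a = trans (Tr-homogeneous a _) (trans (*-congˡ (proj₂ Tr-one)) (*-identityʳ (ι a)))

  -- Coordinates with respect to the basis.

  module Coordinates (γ : Carrier) (u : Vector Carrier r) (basis : IsBasis (γ ∷ u)) where
    coordinates : Carrier → Vector k.Carrier (suc r)
    coordinates x = proj₁ (proj₂ basis x)

    combine-coordinates : ∀ x → linearCombination (coordinates x) (γ ∷ u) ≈ x
    combine-coordinates x = proj₂ (proj₂ basis x)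

    linearCombination-cong : ∀ {a b : Vector k.Carrier (suc r)} → (∀ i → a i k.≈ b i) →
                             linearCombination a (γ ∷ u) ≈ linearCombination b (γ ∷ u)
    linearCombination-cong {a} {b} a≈b =
      sum-cong-≋ {x = λ i → ι (a i) * (γ ∷ u) i} {y = λ i → ι (b i) * (γ ∷ u) i} λ i → *-congʳ (ι-cong (a≈b i))

    -- Adding the combination of the differences to that of `b` gives back that of `b`. Hence the
    -- former vanishes, and independence makes every difference zero.
    linearCombination-injective : ∀ (a b : Vector k.Carrier (suc r)) →
                                  linearCombination a (γ ∷ u) ≈ linearCombination b (γ ∷ u) → ∀ i → a i k.≈ b i
    linearCombination-injective a b a≈b i = k-x∙y⁻¹≈ε⇒x≈y _ _ (proj₁ basis a-b (identityˡ-unique _ _ (begin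
      linearCombination a-b v + linearCombination b v
        ≈⟨ ∑-distrib-+ (λ i → ι (a-b i) * v i) (λ i → ι (b i) * v i) ⟨
      sum (λ i → ι (a-b i) * v i + ι (b i) * v i)
        ≈⟨ sum-cong-≋ {x = λ i → ι (a-b i) * v i + ι (b i) * v i} {y = λ i → ι (a i) * v i} termwise ⟩
      linearCombination a v                              ≈⟨ a≈b ⟩
      linearCombination b v                              ∎)) i)
      where
      open GroupProperties k.+-group using () renaming (x∙y⁻¹≈ε⇒x≈y to k-x∙y⁻¹≈ε⇒x≈y)
      v : Vector Carrier (suc r)
      v = γ ∷ u
      a-b : Vector k.Carrier (suc r)
      a-b i = a i k.- b i
      termwise : ∀ i → ι (a-b i) * v i + ι (b i) * v i ≈ ι (a i) * v i
      termwise i = begin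
        ι (a-b i) * v i + ι (b i) * v i  ≈⟨ distribʳ (v i) (ι (a-b i)) (ι (b i)) ⟨
        (ι (a-b i) + ι (b i)) * v i      ≈⟨ *-congʳ (+-comm _ _) ⟩
        (ι (b i) + ι (a-b i)) * v i      ≈⟨ *-congʳ (ι-+ (b i) (a-b i)) ⟨
        ι (b i k.+ a-b i) * v i          ≈⟨ *-congʳ (ι-cong (kₚ.x≈y+[x-y] (a i) (b i))) ⟨
        ι (a i) * v i                    ∎

    coordinates-unique : ∀ (a : Vector k.Carrier (suc r)) {x} → linearCombination a (γ ∷ u) ≈ x →
                         ∀ i → coordinates x i k.≈ a i
    coordinates-unique a {x} a≈x =
      linearCombination-injective (coordinates x) a (trans (combine-coordinates x) (sym a≈x))

    coordinates-cong : ∀ {x y} → x ≈ y → ∀ i → coordinates x i k.≈ coordinates y i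
    coordinates-cong x≈y = coordinates-unique _ (trans (combine-coordinates _) (sym x≈y))

    γ-coordinate : Carrier → k.Carrier
    γ-coordinate x = coordinates x zero

    γ-coordinate-cong : ∀ {x y} → x ≈ y → γ-coordinate x k.≈ γ-coordinate y
    γ-coordinate-cong x≈y = coordinates-cong x≈y zero

    γ-coordinate-0 : γ-coordinate 0# k.≈ k.0#
    γ-coordinate-0 = coordinates-unique (λ _ → k.0#) (trans
      (sum-cong-≋ {x = λ i → ι k.0# * (γ ∷ u) i} {y = λ _ → 0#} λ i → trans (*-congʳ ι-0) (zeroˡ _))
      (sum-replicate-zero (suc r))) zero

    γ-coordinate-+γ : ∀ x → γ-coordinate (x + γ) k.≈ γ-coordinate x k.+ k.1#
    γ-coordinate-+γ x = coordinates-unique (γ-coordinate x k.+ k.1# ∷ coordinates x ∘ suc) (begin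
      ι (γ-coordinate x k.+ k.1#) * γ + rest       ≈⟨ +-congʳ (*-congʳ (trans (ι-+ _ _) (+-congˡ ι-1))) ⟩
      (ι (γ-coordinate x) + 1#) * γ + rest         ≈⟨ +-congʳ (distribʳ γ _ _) ⟩
      (ι (γ-coordinate x) * γ + 1# * γ) + rest     ≈⟨ +-assoc _ _ _ ⟩
      ι (γ-coordinate x) * γ + (1# * γ + rest)     ≈⟨ +-congˡ (trans (+-comm _ _) (+-congˡ (*-identityˡ γ))) ⟩
      ι (γ-coordinate x) * γ + (rest + γ)          ≈⟨ +-assoc _ _ _ ⟨
      (ι (γ-coordinate x) * γ + rest) + γ          ≈⟨ +-congʳ (combine-coordinates x) ⟩
      x + γ                                        ∎) zero
      where
      rest : Carrier
      rest = sum (λ i → ι (coordinates x (suc i)) * u i)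

    -- The grid of rows and columns, and permutations within its rows.

    -- 𝔽qⁿ is identified with a grid whose rows are the fibres of γ-coordinate.
    row : Carrier → Fin q
    row x = kₚ.index (γ-coordinate x)

    column : Carrier → Fin (q ℕ.^ r)
    column x = funToFin (λ i → kₚ.index (coordinates x (suc i)))

    entryCoordinates : Fin q → Fin (q ℕ.^ r) → Vector k.Carrier (suc r)
    entryCoordinates i j = kₚ.elt i ∷ kₚ.elt ∘ finToFun {q} {r} j

    entry : Fin q → Fin (q ℕ.^ r) → Carrier
    entry i j = linearCombination (entryCoordinates i j) (γ ∷ u)

    row-cong : ∀ {x y} → x ≈ y → row x ≡ row y
    row-cong x≈y = kₚ.index-cong (γ-coordinate-cong x≈y)

    column-cong : ∀ {x y} → x ≈ y → column x ≡ column y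
    column-cong x≈y = funToFin-cong λ i → kₚ.index-cong (coordinates-cong x≈y (suc i))

    γ-coordinate-entry : ∀ i j → γ-coordinate (entry i j) k.≈ kₚ.elt i
    γ-coordinate-entry i j = coordinates-unique (entryCoordinates i j) refl zero

    row-entry : ∀ i j → row (entry i j) ≡ i
    row-entry i j = ≡.trans (kₚ.index-cong (γ-coordinate-entry i j)) (kₚ.index-elt i)

    column-entry : ∀ i j → column (entry i j) ≡ j
    column-entry i j = ≡.trans
      (funToFin-cong λ l → ≡.trans (kₚ.index-cong (coordinates-unique (entryCoordinates i j) refl (suc l))) (kₚ.index-elt _))
      (Fin.funToFin-finToFin {r} {q} j)

    entry-row-column : ∀ x → entry (row x) (column x) ≈ x
    entry-row-column x = trans (linearCombination-cong pointwise) (combine-coordinates x)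
      where
      pointwise : ∀ i → entryCoordinates (row x) (column x) i k.≈ coordinates x i
      pointwise zero    = kₚ.elt-index _
      pointwise (suc i) = k.trans (k.reflexive (≡.cong kₚ.elt (Fin.finToFun-funToFin _ i))) (kₚ.elt-index _)

    -- One permutation for each of the `q` rows is chosen independently, and the `γ-coordinate` is
    -- left alone. These choices are the source of the factor-by-factor count.
    permuteRows : (Fin q → Permutation′ (q ℕ.^ r)) → Carrier → Carrier
    permuteRows π x = entry (row x) (π (row x) ⟨$⟩ʳ column x)

    permuteRows-cong : ∀ π {x y} → x ≈ y → permuteRows π x ≈ permuteRows π y
    permuteRows-cong π {x} {y} x≈y rewrite row-cong x≈y | column-cong x≈y = refl

    γ-coordinate-permuteRows : ∀ π x → γ-coordinate (permuteRows π x) k.≈ γ-coordinate x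
    γ-coordinate-permuteRows π x = k.trans (γ-coordinate-entry _ _) (kₚ.elt-index _)

    -- The hypothesis is one-sided, so exchanging the two families yields both the left and the
    -- right inverse law.
    permuteRows-inverse : ∀ π ρ → (∀ i j → π i ⟨$⟩ʳ (ρ i ⟨$⟩ʳ j) ≡ j) → ∀ x → permuteRows π (permuteRows ρ x) ≈ x
    permuteRows-inverse π ρ πρ≡id x = trans (reflexive eq) (entry-row-column x)
      where
      eq : permuteRows π (permuteRows ρ x) ≡ entry (row x) (column x)
      eq rewrite row-entry (row x) (ρ (row x) ⟨$⟩ʳ column x)
               | column-entry (row x) (ρ (row x) ⟨$⟩ʳ column x)
               | πρ≡id (row x) (column x) = ≡.refl

    permuteRows-bijective : ∀ π → Bijective _≈_ _≈_ (permuteRows π)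
    permuteRows-bijective π =
      (λ {x} {y} eq → trans (sym (leftInverse x)) (trans (permuteRows-cong π⁻¹ eq) (leftInverse y))) ,
      λ y → permuteRows π⁻¹ y , λ eq → trans (permuteRows-cong π eq)
        (permuteRows-inverse π π⁻¹ (λ i j → Perm.inverseʳ (π i)) y)
      where
      π⁻¹ : Fin q → Permutation′ (q ℕ.^ r)
      π⁻¹ = Perm.flip ∘ π
      leftInverse : ∀ x → permuteRows π⁻¹ (permuteRows π x) ≈ x
      leftInverse = permuteRows-inverse π⁻¹ π λ i j → Perm.inverseˡ (π i)

    -- The value of `π i` at `j` is read off as the column of the image of `entry i j`.
    permuteRows-injective : ∀ π ρ → (∀ x → permuteRows π x ≈ permuteRows ρ x) → ∀ i → π i Perm.≈ ρ i
    permuteRows-injective π ρ π≈ρ i j = ≡.trans (≡.sym (column-permuteRows π))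
      (≡.trans (column-cong (π≈ρ (entry i j))) (column-permuteRows ρ))
      where
      column-permuteRows : ∀ π → column (permuteRows π (entry i j)) ≡ π i ⟨$⟩ʳ j
      column-permuteRows π rewrite row-entry i j | column-entry i j = column-entry i (π i ⟨$⟩ʳ j)

    -- Balanced maps and fibre sizes.

    -- Equivalently, all fibres of g have the same size.
    Balanced : (Carrier → k.Carrier) → Set (ℓ₁ ⊔ c₂ ⊔ ℓ₂)
    Balanced g = Σ[ σ ∈ (Carrier → Carrier) ] Bijective _≈_ _≈_ σ × (∀ x → γ-coordinate (σ x) k.≈ g x)

    private
      indicator : k.Carrier → k.Carrier → ℕ
      indicator a b with a kₚ.≟ b
      ... | yes _ = 1
      ... | no  _ = 0

      indicator-mono : ∀ {a a′ b} → (a k.≈ b → a′ k.≈ b) → indicator a b ℕ.≤ indicator a′ b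
      indicator-mono {a} {a′} {b} f with a kₚ.≟ b | a′ kₚ.≟ b
      ... | no _  | _       = z≤n
      ... | yes _ | yes _   = ℕ.≤-refl
      ... | yes p | no ¬p = contradiction (f p) ¬p

      indicator-cong : ∀ {a a′ b} → a k.≈ a′ → indicator a b ≡ indicator a′ b
      indicator-cong a≈a′ = ℕ.≤-antisym (indicator-mono (k.trans (k.sym a≈a′))) (indicator-mono (k.trans a≈a′))

      indicator-< : ∀ {a a′ b} → ¬ a k.≈ b → a′ k.≈ b → indicator a b ℕ.< indicator a′ b
      indicator-< {a} {a′} {b} a≉b a′≈b with a kₚ.≟ b | a′ kₚ.≟ b
      ... | yes a≈b | _         = contradiction a≈b a≉b
      ... | no _    | yes _     = ℕ.≤-refl
      ... | no _    | no a′≉b = contradiction a′≈b a′≉b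

    fibreSize : (Carrier → k.Carrier) → k.Carrier → ℕ
    fibreSize g a = sumℕ (λ i → indicator (g (elt i)) a)

    -- The permutation `σ` reindexes the count. Applied contrapositively: one fibre of the wrong
    -- size rules out balance.
    balanced⇒fibreSize : ∀ {g} → Balanced g → ∀ a → fibreSize g a ≡ fibreSize γ-coordinate a
    balanced⇒fibreSize {g} (σ , σ-bij , cσ≈g) a = ≡.trans
      (sumℕ-cong λ i → indicator-cong (k.trans (k.sym (cσ≈g (elt i))) (γ-coordinate-cong (sym (elt-index (σ (elt i)))))))
      (≡.sym (sumℕ-permute (λ i → indicator (γ-coordinate (elt i)) a) (toPermutation σ-bij)))

    -- Subtracting `γ` lowers the `γ-coordinate` by 1, so following the witness by this translation
    -- undoes the shift.
    balanced-shift : ∀ {g} → Balanced (λ x → g x k.+ k.1#) → Balanced g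
    balanced-shift {g} (σ , σ-bij , cσ≈g+1) = (λ x → σ x - γ) ,
      Composition.bijective _≈_ _≈_ _≈_ σ-bij (+-bijective (- γ)) , λ x →
      k+-cancelʳ k.1# _ _ (k.trans (k.sym (γ-coordinate-+γ (σ x - γ)))
        (k.trans (γ-coordinate-cong (trans (+-comm (σ x - γ) γ) (sym (x≈y+[x-y] (σ x) γ)))) (cσ≈g+1 x)))
      where open GroupProperties k.+-group using () renaming (∙-cancelʳ to k+-cancelʳ)

    -- A permutation whose difference with `t` is unbalanced and nonzero at 0.

    module Difference (t : Carrier → k.Carrier) (t-cong : ∀ {x y} → x ≈ y → t x k.≈ t y)
                      (t-nonconstant : ¬ (∃[ b ] (∀ x → t x k.≈ b))) where
      open GroupProperties k.+-group using () renaming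
        (∙-cancelʳ to k+-cancelʳ; ∙-cancelˡ to k+-cancelˡ; identityʳ-unique to k-identityʳ-unique; ⁻¹-injective to k-neg-injective)

      -- A finite search. If it failed, `t` would agree at any two points with distinct
      -- `γ-coordinate`, and chaining such agreements would make `t` constant.
      separated : ∃[ a ] ∃[ b ] (¬ t a k.≈ t b) × ¬ (γ-coordinate a k.≈ γ-coordinate b)
      separated with Fin.any? (λ i → Fin.any? λ j → ¬? (t (elt i) kₚ.≟ t (elt j)) ×-dec
                              ¬? (γ-coordinate (elt i) kₚ.≟ γ-coordinate (elt j)))
      ... | yes (i , j , sep) = elt i , elt j , sep
      ... | no ¬sep = contradiction (t 0# , constant) t-nonconstant
        where
        agree : ∀ x y → ¬ (γ-coordinate x k.≈ γ-coordinate y) → t x k.≈ t y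
        agree x y cx≉cy = decidable-stable (t x kₚ.≟ t y) λ tx≉ty → ¬sep (index x , index y ,
          (λ eq → tx≉ty (k.trans (t-cong (sym (elt-index x))) (k.trans eq (t-cong (elt-index y))))) ,
          (λ eq → cx≉cy (k.trans (γ-coordinate-cong (sym (elt-index x))) (k.trans eq (γ-coordinate-cong (elt-index y))))))

        c[x+γ]≉cx : ∀ x → ¬ (γ-coordinate (x + γ) k.≈ γ-coordinate x)
        c[x+γ]≉cx x eq = k.1≉0 (k-identityʳ-unique _ _ (k.trans (k.sym (γ-coordinate-+γ x)) eq))

        -- If x and 0 have the same γ-coordinate, compare both with x + γ.
        constant : ∀ x → t x k.≈ t 0#
        constant x with γ-coordinate x kₚ.≟ γ-coordinate 0#
        ... | no  cx≉c0 = agree x 0# cx≉c0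
        ... | yes cx≈c0 = k.trans (agree x (x + γ) (c[x+γ]≉cx x ∘ k.sym))
                                  (agree (x + γ) 0# λ eq → c[x+γ]≉cx x (k.trans eq (k.sym cx≈c0)))

      difference : (Carrier → Carrier) → Carrier → k.Carrier
      difference w x = γ-coordinate (w x) k.- t x

      -- Exchanging the values at two separated points moves a out of the fibre
      -- of its own value and nothing into it.
      fibreSize-swap : ∀ a b → ¬ t a k.≈ t b → ¬ (γ-coordinate a k.≈ γ-coordinate b) →
                       let v = γ-coordinate a k.- t a in
                       fibreSize (difference (swap a b)) v ℕ.< fibreSize (difference (λ x → x)) v
      fibreSize-swap a b ta≉tb ca≉cb = sumℕ-mono-< (λ i → indicator-mono (preserves (elt i) (elt i ≟ a) (elt i ≟ b))) (index a)
        (indicator-< (moved (elt-index a)) (k.+-cong (γ-coordinate-cong (elt-index a)) (k.-‿cong (t-cong (elt-index a)))))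
        where
        v = γ-coordinate a k.- t a

        moved : ∀ {x} → x ≈ a → ¬ (difference (swap a b) x k.≈ v)
        moved {x} x≈a eq = ca≉cb (k.sym (k+-cancelʳ (k.- t a) _ _ (k.trans
          (k.+-cong (γ-coordinate-cong (sym (swap-left a b x≈a))) (k.-‿cong (t-cong (sym x≈a)))) eq)))

        preserves : ∀ x → Dec (x ≈ a) → Dec (x ≈ b) → difference (swap a b) x k.≈ v → difference (λ x → x) x k.≈ v
        preserves x (yes x≈a) _         eq = contradiction eq (moved x≈a)
        -- At `b` the swapped difference is the `γ-coordinate` of `a` minus `t b`; it equals `v`
        -- only if `t a` and `t b` agree.
        preserves x (no _)    (yes x≈b) eq = contradiction
          (k.sym (k-neg-injective (k+-cancelˡ (γ-coordinate a) _ _ (k.trans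
            (k.+-cong (γ-coordinate-cong (sym (swap-right a b x≈b))) (k.-‿cong (t-cong (sym x≈b)))) eq)))) ta≉tb
        preserves x (no x≉a)  (no x≉b)  eq = k.trans (k.+-congʳ (γ-coordinate-cong (sym (swap-other a b x≉a x≉b)))) eq

      -- Over one value the fibre for the swap is strictly smaller than the fibre for the identity,
      -- so they cannot both have the size of the fibre of `γ-coordinate`.
      unbalancedDifference : ∃[ w ] Bijective _≈_ _≈_ w × (∀ {x y} → x ≈ y → w x ≈ w y) × ¬ Balanced (difference w)
      unbalancedDifference with separated
      ... | a , b , ta≉tb , ca≉cb
        with fibreSize (difference (λ x → x)) (γ-coordinate a k.- t a) ℕ.≟ fibreSize γ-coordinate (γ-coordinate a k.- t a)
      ... | no ≢ = (λ x → x) , Identity.bijective _≈_ , (λ eq → eq) , λ balanced → ≢ (balanced⇒fibreSize balanced _)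
      ... | yes ≡id = swap a b , swap-bijective a b , swap-cong a b , λ balanced →
        ℕ.<-irrefl (≡.trans (balanced⇒fibreSize balanced _) (≡.sym ≡id)) (fibreSize-swap a b ta≉tb ca≉cb)

      -- The value at 0 will exclude linearized maps. If it vanishes, adding `γ` to `w` raises the
      -- difference by 1 everywhere: the value at 0 becomes 1, and `balanced-shift` carries the
      -- imbalance over.
      basePermutation : ∃[ w ] Bijective _≈_ _≈_ w × (∀ {x y} → x ≈ y → w x ≈ w y)
                             × ¬ Balanced (difference w) × ¬ difference w 0# k.≈ k.0#
      basePermutation with unbalancedDifference
      ... | w , w-bij , w-cong , unbalanced with difference w 0# kₚ.≟ k.0#
      ...   | no  ≉0 = w , w-bij , w-cong , unbalanced , ≉0
      ...   | yes ≈0 = (λ x → w x + γ) , Composition.bijective _≈_ _≈_ _≈_ w-bij (+-bijective γ) , (λ eq → +-congʳ (w-cong eq)) ,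
        (λ (σ , σ-bij , cσ≈) → unbalanced (balanced-shift (σ , σ-bij , λ x → k.trans (cσ≈ x) (shifted x)))) ,
        λ ≈0′ → k.1≉0 (k.trans (k.sym (k.trans (k.+-congʳ ≈0) (k.+-identityˡ k.1#))) (k.trans (k.sym (shifted 0#)) ≈0′))
        where
        shifted : ∀ x → difference (λ y → w y + γ) x k.≈ difference w x k.+ k.1#
        shifted x = k.trans (k.+-congʳ (γ-coordinate-+γ (w x))) (k.trans (k.+-assoc _ _ _)
          (k.trans (k.+-congˡ (k.+-comm _ _)) (k.sym (k.+-assoc _ _ _))))

    -- The family of permutation polynomials and their required form.

    module Family (H : Poly) (Tr-nonconstant : ¬ IsConstant (λ x → Tr (⟦ H ⟧ x))) where
      ⟦⟧-cong : ∀ P {x y} → x ≈ y → ⟦ P ⟧ x ≈ ⟦ P ⟧ y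
      ⟦⟧-cong List.[]         x≈y = refl
      ⟦⟧-cong (a List.∷ P) x≈y = +-congˡ (*-cong x≈y (⟦⟧-cong P x≈y))

      t : Carrier → k.Carrier
      t x = proj₁ (Tr∈ι (⟦ H ⟧ x))

      ι-t : ∀ x → ι (t x) ≈ Tr (⟦ H ⟧ x)
      ι-t x = proj₂ (Tr∈ι (⟦ H ⟧ x))

      -- The chosen preimages respect equality because `ι` is injective.
      t-cong : ∀ {x y} → x ≈ y → t x k.≈ t y
      t-cong x≈y = ι-injective (trans (ι-t _) (trans (Tr-cong (⟦⟧-cong H x≈y)) (sym (ι-t _))))

      open Difference t t-cong (λ (b , t≈b) → Tr-nonconstant (ι b , λ x → trans (sym (ι-t x)) (ι-cong (t≈b x))))

      base : Carrier → Carrier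
      base = proj₁ basePermutation

      base-bijective = proj₁ (proj₂ basePermutation)
      base-unbalanced = proj₁ (proj₂ (proj₂ (proj₂ basePermutation)))
      base-0 = proj₂ (proj₂ (proj₂ (proj₂ basePermutation)))

      base-cong : ∀ {x y} → x ≈ y → base x ≈ base y
      base-cong = proj₁ (proj₂ (proj₂ basePermutation))

      -- A number with `q` digits in base `(q ^ r) !`, each digit coding the permutation of one row.
      Index : Set
      Index = Fin (((q ℕ.^ r) ℕ.!) ℕ.^ q)

      rowPermutations : Index → Fin q → Permutation′ (q ℕ.^ r)
      rowPermutations s i = nthPermutation (q ℕ.^ r) (finToFun {(q ℕ.^ r) ℕ.!} {q} s i)

      member : Index → Carrier → Carrier
      member s x = permuteRows (rowPermutations s) (base x)

      member-cong : ∀ s {x y} → x ≈ y → member s x ≈ member s y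
      member-cong s x≈y = permuteRows-cong (rowPermutations s) (base-cong x≈y)

      member-bijective : ∀ s → Bijective _≈_ _≈_ (member s)
      member-bijective s = Composition.bijective _≈_ _≈_ _≈_ base-bijective (permuteRows-bijective (rowPermutations s))

      -- Surjectivity of `base` allows cancelling it; the row permutations, then their codes, then
      -- the digits of the indices agree.
      member-injective : ∀ {s s′} → (∀ x → member s x ≈ member s′ x) → s ≡ s′
      member-injective {s} {s′} eq = finToFun-injective ((q ℕ.^ r) ℕ.!) q λ i → nthPermutation-injective (q ℕ.^ r)
        (permuteRows-injective (rowPermutations s) (rowPermutations s′) agree i)
        where
        agree : ∀ y → permuteRows (rowPermutations s) y ≈ permuteRows (rowPermutations s′) y
        agree y = trans (permuteRows-cong (rowPermutations s) (sym base≈y))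
          (trans (eq x) (permuteRows-cong (rowPermutations s′) base≈y))
          where
          x = proj₁ (proj₂ base-bijective y)
          base≈y = proj₂ (proj₂ base-bijective y) refl

      polynomial : Index → Poly
      polynomial s = proj₁ (interpolation (member s) (member-cong s))

      ⟦polynomial⟧ : ∀ s x → ⟦ polynomial s ⟧ x ≈ member s x
      ⟦polynomial⟧ s = proj₂ (interpolation (member s) (member-cong s))

      polynomial-injective : ∀ {s s′} → (∀ x → ⟦ polynomial s ⟧ x ≈ ⟦ polynomial s′ ⟧ x) → s ≡ s′
      polynomial-injective {s} {s′} eq =
        member-injective λ x → trans (sym (⟦polynomial⟧ s x)) (trans (eq x) (⟦polynomial⟧ s′ x))

      f : Index → Vector (Func K.setoid k.setoid) r
      f s i = record
        { to   = λ x → coordinates (member s x) (suc i)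
        ; cong = λ x≈y → coordinates-cong (member-cong s x≈y) (suc i)
        }

      γ-part : Index → Carrier → k.Carrier
      γ-part s x = γ-coordinate (member s x) k.- t x

      γ-part-cong : ∀ s {x y} → x ≈ y → γ-part s x k.≈ γ-part s y
      γ-part-cong s x≈y = k.+-cong (γ-coordinate-cong (member-cong s x≈y)) (k.-‿cong (t-cong x≈y))

      γ-part≈difference : ∀ s x → γ-part s x k.≈ difference base x
      γ-part≈difference s x = k.+-congʳ (γ-coordinate-permuteRows (rowPermutations s) (base x))

      H₁-interpolation : ∀ s → Σ[ P ∈ Poly ] (∀ x → ⟦ P ⟧ x ≈ Tr-section (γ-part s x))
      H₁-interpolation s = interpolation (λ x → Tr-section (γ-part s x)) (λ x≈y → Tr-section-cong (γ-part-cong s x≈y))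

      H₁ : Index → Poly
      H₁ s = proj₁ (H₁-interpolation s)

      Tr-H₁ : ∀ s x → Tr (⟦ H₁ s ⟧ x) ≈ ι (γ-part s x)
      Tr-H₁ s x = trans (Tr-cong (proj₂ (H₁-interpolation s) x)) (Tr-Tr-section (γ-part s x))

      rest : Index → Carrier → Carrier
      rest s x = sum (λ i → u i * ι (Func.to (f s i) x))

      rest≈ : ∀ s x → rest s x ≈ sum (λ i → ι (coordinates (member s x) (suc i)) * u i)
      rest≈ s x = sum-cong-≋ {r} λ i → *-comm (u i) _

      -- Row permutations preserve the `γ-coordinate`, so the result does not depend on `s`. Both
      -- negative conditions on `G` are decided by this coordinate.
      γ-coordinate-G : ∀ s x → γ-coordinate (G u γ (f s) (H₁ s) x) k.≈ difference base x
      γ-coordinate-G s x = k.trans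
        (coordinates-unique (γ-part s x ∷ coordinates (member s x) ∘ suc) combination zero) (γ-part≈difference s x)
        where
        combination : linearCombination (γ-part s x ∷ coordinates (member s x) ∘ suc) (γ ∷ u) ≈ G u γ (f s) (H₁ s) x
        combination = trans (+-comm _ _) (+-cong (sym (rest≈ s x)) (trans (*-comm _ γ) (*-congˡ (sym (Tr-H₁ s x)))))

      -- `H₁` was chosen so that its trace is the `γ-coordinate` minus `t`; the trace of `H` is `t`,
      -- and adding it restores the coordinate.
      decomposition : ∀ s x → ⟦ polynomial s ⟧ x ≈ G u γ (f s) (H₁ s) x + γ * Tr (⟦ H ⟧ x)
      decomposition s x = begin
        ⟦ polynomial s ⟧ x                                 ≈⟨ ⟦polynomial⟧ s x ⟩
        member s x                                         ≈⟨ combine-coordinates (member s x) ⟨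
        ι (γ-coordinate (member s x)) * γ + _              ≈⟨ +-cong γ-term (sym (rest≈ s x)) ⟩
        (γ * Tr (⟦ H₁ s ⟧ x) + γ * Tr (⟦ H ⟧ x)) + rest s x ≈⟨ +-comm _ _ ⟩
        rest s x + (γ * Tr (⟦ H₁ s ⟧ x) + γ * Tr (⟦ H ⟧ x)) ≈⟨ +-assoc _ _ _ ⟨
        G u γ (f s) (H₁ s) x + γ * Tr (⟦ H ⟧ x)            ∎
        where
        γ-term : ι (γ-coordinate (member s x)) * γ ≈ γ * Tr (⟦ H₁ s ⟧ x) + γ * Tr (⟦ H ⟧ x)
        γ-term = begin
          ι (γ-coordinate (member s x)) * γ            ≈⟨ *-comm _ γ ⟩
          γ * ι (γ-coordinate (member s x))
            ≈⟨ *-congˡ (ι-cong (kₚ.x≈y+[x-y] (γ-coordinate (member s x)) (t x))) ⟩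
          γ * ι (t x k.+ γ-part s x)                   ≈⟨ *-congˡ (trans (ι-+ _ _) (+-comm _ _)) ⟩
          γ * (ι (γ-part s x) + ι (t x))               ≈⟨ *-congˡ (+-cong (Tr-H₁ s x) (sym (ι-t x))) ⟨
          γ * (Tr (⟦ H₁ s ⟧ x) + Tr (⟦ H ⟧ x))         ≈⟨ distribˡ γ _ _ ⟩
          γ * Tr (⟦ H₁ s ⟧ x) + γ * Tr (⟦ H ⟧ x)       ∎

      linearized-0 : ∀ {g} → IsLinearized g → g 0# ≈ 0#
      linearized-0 {g} (a , g≈) = begin
        g 0#                                          ≈⟨ g≈ 0# ⟩
        sum (λ i → a i * 0# ^ (q ℕ.^ toℕ i))
          ≈⟨ sum-cong-≋ {suc r} (λ i → trans (*-congˡ (0^n≈0 (q^i>0 (toℕ i)))) (zeroʳ (a i))) ⟩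
        sum (replicate (suc r) 0#)                    ≈⟨ sum-replicate-zero (suc r) ⟩
        0#                                            ∎
        where
        q^i>0 : ∀ i → 0 ℕ.< q ℕ.^ i
        q^i>0 i = ℕ.m^n>0 q {{ℕ.>-nonZero (ℕ.<⇒≤ kₚ.1<size)}} i

      polynomial-permutationOfForm : ∀ s → IsPermutationOfForm u γ H (polynomial s)
      polynomial-permutationOfForm s =
        Bijective-≈ (λ x → sym (⟦polynomial⟧ s x)) (member-bijective s) ,
        f s , H₁ s , decomposition s ,
        -- A bijective `G` would itself be a witness that the difference of `base` is balanced.
        (λ G-bij → base-unbalanced (G u γ (f s) (H₁ s) , G-bij , γ-coordinate-G s)) ,
        -- A linearized `G` vanishes at 0, and so does its `γ-coordinate` there, against the choice
        -- of `base`.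
        λ G-lin → base-0 (k.trans (k.sym (γ-coordinate-G s 0#))
                           (k.trans (γ-coordinate-cong (linearized-0 G-lin)) γ-coordinate-0))

-- The list of all members and its length.

open import Data.Integer.Base using (+_)
open import Data.Nat.Base using (NonZero; pred; _^_; _!)

theorem4p1 : ∀ {c₁ ℓ₁ c₂ ℓ₂} (q n : ℕ) → IsPrimePower q → .{{_ : NonZero n}} →
    (E : FiniteFieldExtension c₁ ℓ₁ c₂ ℓ₂ q n) →
    let open FiniteFieldExtension E in
    (γ : K.Carrier) → ¬ (γ K.≈ K.0#) →
    (u : Vector K.Carrier (pred n)) → IsBasis (γ ∷ u) →
    (H : Poly) → ¬ IsConstant (λ x → Tr (⟦ H ⟧ x)) →
    ∃[ Ps ] Unique polySetoid Ps
    × All (IsPermutationOfForm u γ H) Ps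
    × + (((q ^ pred n) !) ^ q) ℤ.- + factorProduct q n ℤ.≤ + length Ps
theorem4p1 q (suc r) q-primePower E γ _ u basis H Tr-nonconstant =
  tabulate polynomial ,
  UniqueProperties.tabulate⁺ polySetoid polynomial-injective ,
  AllProperties.tabulate⁺ polynomial-permutationOfForm ,
  -- The length equals the first term of the bound, and subtracting a natural number in the integers
  -- cannot exceed it.
  ≡.subst (λ l → + (((q ^ r) !) ^ q) ℤ.- + factorProduct q (suc r) ℤ.≤ + l)
    (≡.sym (length-tabulate polynomial))
    (ℤ.i-j≤i _ (+ factorProduct q (suc r)))
  where
  open FiniteFieldExtension E
  open ExtensionProperties E q-primePower
  open Coordinates γ u basis
  open Family H Tr-nonconstant
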